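{- Let $T$ be a monoid with a fixed generating set $G$, let $M$ be a $G$-uniform $T$-graded monad on $\mathbf{Set}$, and let $\mathcal{L}=(\Theta,\mathcal{O},\Lambda)$ be a trace logic for $M$. Then the uniform-depth fragment of $\mathcal{L}$ is invariant with respect to trace equivalence in graded $M$-coalgebras: if states $x\in X$ and $y\in Y$ of graded $M$-coalgebras $(X,\gamma)$ and $(Y,\delta)$ are trace equivalent, then $[\![\phi]\!]_\gamma(x)=[\![\phi]\!]_\delta(y)$ for every $k\in T$ and every formula $\phi\in\mathcal{F}_k(\mathcal{L})$ of uniform depth $k$.
   Context: A $T$-graded monad $M$ on $\mathbf{Set}$, for a monoid $(T,\cdot,e)$, consists of endofunctors $M_t$ ($t\in T$) and natural transformations $\mu^{s,t}\colon M_sM_t\to M_{s\cdot t}$, $\eta\colon\mathrm{Id}\to M_e$ such that $\mu^{r,s\cdot t}\circ M_r\mu^{s,t}=\mu^{r\cdot s,t}\circ\mu^{r,s}M_t$ and $\mu^{t,e}\circ M_t\eta=\mathrm{id}=\mu^{e,t}\circ\eta M_t$; in particular $(M_e,\mu^{e,e},\eta)$ is a monad and $(M_tX,\mu^{e,t}_X)$ is an $M_e$-algebra. A graded $M$-coalgebra is a set $X$ with maps $\gamma_t\colon X\to M_tX$ such that $\gamma_e=\eta_X$ and $\gamma_{s\cdot t}=\mu^{s,t}_X\circ M_s\gamma_t\circ\gamma_s$. States $x\in X$, $y\in Y$ of $(X,\gamma)$, $(Y,\delta)$ are trace equivalent if $M_t(!_X)(\gamma_t(x))=M_t(!_Y)(\delta_t(y))$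 for all $t\in T$, where $!_X\colon X\to1$ and $!_Y\colon Y\to1$. $M$ is $G$-uniform if for all $g\in G$, $t\in T$ the map $\mu^{g,t}\colon M_gM_t\to M_{g\cdot t}$ is (at each set $X$) a coequalizer of $M_g\mu^{e,t},\ \mu^{g,e}M_t\colon M_gM_eM_t\to M_gM_t$ in the Eilenberg-Moore category of $(M_e,\mu^{e,e},\eta)$. A graded coalgebraic modal logic $\mathcal{L}=(\Theta,\mathcal{O},\Lambda)$ consists of a set $\Theta$ of constants, a set $\mathcal{O}$ of propositional operators $p$ with finite arities $\mathrm{ar}(p)\in\mathbb{N}$, and a set $\Lambda$ of (unary) modal operators $\lambda$ with depths $\mathsf{d}(\lambda)\in G$. The semantics is given by a set $\Omega$, elements $\hat\theta\colon1\to\Omega$, maps $[\![p]\!]\colon\Omega^{\mathrm{ar}(p)}\to\Omega$ and maps $[\![\lambda]\!]\colon M_{\mathsf{d}(\lambda)}\Omega\to\Omega$. For a graded coalgebra $(X,\gamma)$, $[\![\phi]\!]_\gamma\colon X\to\Omega$ is defined by: $[\![\theta]\!]_\gamma$ is constant with value $\hat\theta$; $[\![p(\phi_1,\dots,\phi_n)]\!]_\gamma=[\![p]\!]\circ\langle[\![\phi_1]\!]_\gamma,\dots,[\![\phi_n]\!]_\gamma\rangle$; $[\![\lambda\phi]\!]_\gamma=[\![\lambda]\!]\circ M_{\mathsf{d}(\lambda)}[\![\phi]\!]_\gamma\circ\gamma_{\mathsf{d}(\lambda)}$. $\mathcal{L}$ is a trace logic if (i) $\Omega$ carries an $M_e$-algebra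 structure $o\colon M_e\Omega\to\Omega$; (ii) each $[\![p]\!]\colon(\Omega,o)^n\to(\Omega,o)$ is an $M_e$-algebra homomorphism; (iii) for each $\lambda\in\Lambda$ of depth $t$: $[\![\lambda]\!]\circ\mu^{t,e}_\Omega=[\![\lambda]\!]\circ M_to$ and $[\![\lambda]\!]\circ\mu^{e,t}_\Omega=o\circ M_e[\![\lambda]\!]$. The sets $\mathcal{F}_k(\mathcal{L})$ ($k\in T$) of formulae of uniform depth $k$ are defined inductively: $\theta\in\mathcal{F}_e(\mathcal{L})$ for $\theta\in\Theta$; $p(\phi_1,\dots,\phi_n)\in\mathcal{F}_k(\mathcal{L})$ if $p\in\mathcal{O}$, $n=\mathrm{ar}(p)$ and all $\phi_i\in\mathcal{F}_k(\mathcal{L})$; $\lambda\phi\in\mathcal{F}_k(\mathcal{L})$ if $\phi\in\mathcal{F}_l(\mathcal{L})$ with $\mathsf{d}(\lambda)\cdot l=k$. The uniform-depth fragment is $\bigcup_{k\in T}\mathcal{F}_k(\mathcal{L})$. -}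

module Defs where

open import Algebra.Structures using (IsMonoid)
open import Axiom.UniquenessOfIdentityProofs.WithK using (uip)
open import Data.List.Base using (List; foldr)
import Data.List.Relation.Unary.All as List
open import Data.Nat.Base using (ℕ)
open import Data.Product.Base using (Σ; ∃-syntax; _×_)
open import Data.Unit.Polymorphic.Base using (⊤; tt)
open import Data.Vec.Base using (Vec; []; _∷_; lookup; tabulate)
import Data.Vec.Relation.Unary.All as Vec
open import Data.Vec.Properties using (tabulate-cong; tabulate∘lookup; lookup∘tabulate)
open import Function.Base using (id; _∘_; const)
open import Level using (Level; _⊔_) renaming (suc to lsuc)
open import Relation.Binary.PropositionalEquality
  using (_≡_; _≗_; refl; sym; trans; cong; subst; module ≡-Reasoning)

private
  variable
    a g ℓ : Level

-- The category Set is the universe Set ℓ with functions up to pointwise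
-- equality _≗_.  Function extensionality is not available, so a functor has to
-- be required to respect _≗_.

record Functor (ℓ : Level) : Set (lsuc ℓ) where
  field
    F₀           : Set ℓ → Set ℓ
    F₁           : ∀ {A B} → (A → B) → F₀ A → F₀ B
    F-resp-≗     : ∀ {A B} {f h : A → B} → f ≗ h → F₁ f ≗ F₁ h
    identity     : ∀ {A} → F₁ (id {A = A}) ≗ id
    homomorphism : ∀ {A B C} (f : A → B) (h : B → C) → F₁ (h ∘ f) ≗ F₁ h ∘ F₁ f

record Monad (ℓ : Level) : Set (lsuc ℓ) where
  field
    functor : Functor ℓ

  open Functor functor public

  field
    η         : ∀ {A} → A → F₀ A
    μ         : ∀ {A} → F₀ (F₀ A) → F₀ A
    η-natural : ∀ {A B} (f : A → B) → η ∘ f ≗ F₁ f ∘ η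
    μ-natural : ∀ {A B} (f : A → B) → μ ∘ F₁ (F₁ f) ≗ F₁ f ∘ μ
    assoc     : ∀ {A} → μ {A} ∘ F₁ μ ≗ μ ∘ μ
    identityˡ : ∀ {A} → μ {A} ∘ F₁ η ≗ id
    identityʳ : ∀ {A} → μ {A} ∘ η ≗ id

module EilenbergMoore {ℓ : Level} (𝕄 : Monad ℓ) where
  open Monad 𝕄

  record IsAlgebra {A : Set ℓ} (act : F₀ A → A) : Set ℓ where
    field
      unit : act ∘ η ≗ id
      mult : act ∘ F₁ act ≗ act ∘ μ

  record Algebra : Set (lsuc ℓ) where
    field
      {Carrier} : Set ℓ
      act       : F₀ Carrier → Carrier
      isAlgebra : IsAlgebra act

    open IsAlgebra isAlgebra public

  open Algebra using (Carrier; act)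

  IsHom : (A B : Algebra) → (Carrier A → Carrier B) → Set ℓ
  IsHom A B f = f ∘ act A ≗ act B ∘ F₁ f

  record Hom (A B : Algebra) : Set ℓ where
    field
      fun   : Carrier A → Carrier B
      isHom : IsHom A B fun

  open Hom using (fun)

  record IsCoequalizer {A B C : Algebra} (h k : Hom A B) (q : Hom B C) : Set (lsuc ℓ) where
    field
      equality  : fun q ∘ fun h ≗ fun q ∘ fun k
      universal : ∀ (D : Algebra) (f : Hom B D) → fun f ∘ fun h ≗ fun f ∘ fun k →
                  ∃[ u ] (fun {C} {D} u ∘ fun q ≗ fun f
                    × (∀ (v : Hom C D) → fun v ∘ fun q ≗ fun f → fun v ≗ fun u))

  -- The n-fold power in the Eilenberg–Moore category.  Its carrier is Vec A n
  -- rather than Fin n → A, as equality of the latter is not pointwise.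

  power-act : (A : Algebra) (n : ℕ) → F₀ (Vec (Carrier A) n) → Vec (Carrier A) n
  power-act A n m = tabulate (λ i → act A (F₁ (λ v → lookup v i) m))

  power : Algebra → ℕ → Algebra
  power A n = record
    { act       = power-act A n
    ; isAlgebra = record
      { unit = λ v → trans
          (tabulate-cong (λ i → trans (cong (act A) (sym (η-natural (λ w → lookup w i) v)))
                                      (A.unit (lookup v i))))
          (tabulate∘lookup v)
      ; mult = λ m → tabulate-cong (λ i → begin
          act A (F₁ (λ v → lookup v i) (F₁ (power-act A n) m))
            ≡⟨ cong (act A) (homomorphism (power-act A n) (λ v → lookup v i) m) ⟨
          act A (F₁ (λ x → lookup (power-act A n x) i) m)
            ≡⟨ cong (act A) (F-resp-≗ (λ x → lookup∘tabulate _ i) m) ⟩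
          act A (F₁ (λ x → act A (F₁ (λ v → lookup v i) x)) m)
            ≡⟨ cong (act A) (homomorphism (F₁ (λ v → lookup v i)) (act A) m) ⟩
          act A (F₁ (act A) (F₁ (F₁ (λ v → lookup v i)) m))
            ≡⟨ A.mult _ ⟩
          act A (μ (F₁ (F₁ (λ v → lookup v i)) m))
            ≡⟨ cong (act A) (μ-natural (λ v → lookup v i) m) ⟩
          act A (F₁ (λ v → lookup v i) (μ m)) ∎)
      }
    }
    where
    module A = Algebra A
    open ≡-Reasoning

module _ {T : Set a} {_∙_ : T → T → T} {e : T} (isMonoid : IsMonoid _≡_ _∙_ e) where

  Generates : (T → Set g) → Set (a ⊔ g)
  Generates G = ∀ t → ∃[ gs ] (List.All G gs × foldr _∙_ e gs ≡ t)

  private module T = IsMonoid isMonoid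

  -- The laws of μ relate elements of M (r ∙ (s ∙ t)) A and M ((r ∙ s) ∙ t) A, and
  -- so on; cast transports along the monoid equations that the usual notation
  -- leaves implicit.

  record GradedMonad (ℓ : Level) : Set (a ⊔ lsuc ℓ) where
    field
      functor : T → Functor ℓ

    M : T → Set ℓ → Set ℓ
    M t = Functor.F₀ (functor t)

    fmap : ∀ {t A B} → (A → B) → M t A → M t B
    fmap {t} = Functor.F₁ (functor t)

    cast : ∀ {s t A} → s ≡ t → M s A → M t A
    cast {A = A} = subst (λ u → M u A)

    field
      η         : ∀ {A} → A → M e A
      μ         : ∀ s t {A} → M s (M t A) → M (s ∙ t) A
      η-natural : ∀ {A B} (f : A → B) → η ∘ f ≗ fmap f ∘ η
      μ-natural : ∀ s t {A B} (f : A → B) → μ s t ∘ fmap (fmap f) ≗ fmap f ∘ μ s t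
      assoc     : ∀ r s t {A} →
                  μ r (s ∙ t) ∘ fmap (μ s t {A}) ≗ cast (T.assoc r s t) ∘ μ (r ∙ s) t ∘ μ r s
      identityˡ : ∀ t {A} → cast (T.identityʳ t) ∘ μ t e {A} ∘ fmap η ≗ id
      identityʳ : ∀ t {A} → cast (T.identityˡ t) ∘ μ e t {A} ∘ η ≗ id

    -- μ^{t,e} and μ^{e,t}, with codomain M_t along t ∙ e ≡ t and e ∙ t ≡ t.

    μʳ : ∀ t {A} → M t (M e A) → M t A
    μʳ t = cast (T.identityʳ t) ∘ μ t e

    μˡ : ∀ t {A} → M e (M t A) → M t A
    μˡ t = cast (T.identityˡ t) ∘ μ e t

    private
      fmap-cast : ∀ {s t A B} (p : s ≡ t) (f : A → B) → fmap f ∘ cast p ≗ cast p ∘ fmap f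
      fmap-cast refl f m = refl

      μ-castˡ : ∀ {s s′ t A} (p : s ≡ s′) (q : s ∙ t ≡ s′ ∙ t) →
                μ s′ t {A} ∘ cast p ≗ cast q ∘ μ s t
      μ-castˡ refl refl m = refl

      μ-castʳ : ∀ {s t t′ A} (p : t ≡ t′) (q : s ∙ t ≡ s ∙ t′) →
                μ s t′ {A} ∘ fmap (cast p) ≗ cast q ∘ μ s t
      μ-castʳ {s} {t} refl refl m = cong (μ s t) (Functor.identity (functor s) m)

      cast-cast : ∀ {s t u A} (p : s ≡ t) (q : t ≡ u) (r : s ≡ u) →
                  cast {A = A} q ∘ cast p ≗ cast r
      cast-cast refl refl refl m = refl

      assoc′ : ∀ {r s t st rs u A} (p : s ∙ t ≡ st) (q : r ∙ st ≡ u)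
               (p′ : r ∙ s ≡ rs) (q′ : rs ∙ t ≡ u) →
               (cast q ∘ μ r st) ∘ fmap (cast p ∘ μ s t {A})
                 ≗ (cast q′ ∘ μ rs t) ∘ (cast p′ ∘ μ r s)
      assoc′ {r} {s} {t} refl q refl q′ m =
        trans (cong (cast q) (assoc r s t m)) (cast-cast (T.assoc r s t) q q′ _)

      μ-natural′ : ∀ {s t u A B} (p : s ∙ t ≡ u) (f : A → B) →
                   (cast p ∘ μ s t) ∘ fmap (fmap f) ≗ fmap f ∘ (cast p ∘ μ s t)
      μ-natural′ {s} {t} refl f m = μ-natural s t f m

    base : Monad ℓ
    base = record
      { functor   = functor e
      ; η         = η
      ; μ         = μˡ e
      ; η-natural = η-natural
      ; μ-natural = μ-natural′ (T.identityˡ e)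
      ; assoc     = assoc′ _ _ _ _
      ; identityˡ = λ m → trans (cong (λ p → cast p (μ e e (fmap η m)))
                                      (uip (T.identityˡ e) (T.identityʳ e)))
                                (identityˡ e m)
      ; identityʳ = identityʳ e
      }

    open EilenbergMoore base public

    algebra : T → Set ℓ → Algebra
    algebra t A = record
      { Carrier   = M t A
      ; act       = μˡ t
      ; isAlgebra = record
        { unit = identityʳ t
        ; mult = assoc′ (T.identityˡ t) (T.identityˡ t) (T.identityˡ e) (T.identityˡ t)
        }
      }

    μ-hom : ∀ s t A → Hom (algebra s (M t A)) (algebra (s ∙ t) A)
    μ-hom s t A = record
      { fun   = μ s t
      ; isHom = λ m → sym (assoc′ refl (T.identityˡ (s ∙ t)) (T.identityˡ s) refl m)
      }

    fmap-μˡ-hom : ∀ s t A → Hom (algebra s (M e (M t A))) (algebra s (M t A))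
    fmap-μˡ-hom s t A = record
      { fun   = fmap (μˡ t)
      ; isHom = λ m → sym (μ-natural′ (T.identityˡ s) (μˡ t) m)
      }

    μʳ-hom : ∀ s t A → Hom (algebra s (M e (M t A))) (algebra s (M t A))
    μʳ-hom s t A = record
      { fun   = μʳ s
      ; isHom = λ m → sym (assoc′ (T.identityʳ s) (T.identityˡ s) (T.identityˡ s) (T.identityʳ s) m)
      }

  module _ {ℓ : Level} (𝕄 : GradedMonad ℓ) where
    open GradedMonad 𝕄

    Uniform : (T → Set g) → Set (a ⊔ g ⊔ lsuc ℓ)
    Uniform G = ∀ s → G s → ∀ t A →
                IsCoequalizer (fmap-μˡ-hom s t A) (μʳ-hom s t A) (μ-hom s t A)

    record Coalgebra (X : Set ℓ) : Set (a ⊔ ℓ) where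
      field
        γ    : ∀ t → X → M t X
        unit : γ e ≗ η
        mult : ∀ s t → γ (s ∙ t) ≗ μ s t ∘ fmap (γ t) ∘ γ s

    TraceEquivalent : ∀ {X Y} → Coalgebra X → Coalgebra Y → X → Y → Set (a ⊔ ℓ)
    TraceEquivalent γ δ x y =
      ∀ t → fmap {B = ⊤} (const tt) (Coalgebra.γ γ t x) ≡ fmap (const tt) (Coalgebra.γ δ t y)

  record Signature (G : T → Set g) (o : Level) : Set (a ⊔ g ⊔ lsuc o) where
    field
      Θ       : Set o
      𝒪       : Set o
      ar      : 𝒪 → ℕ
      Λ       : Set o
      depth   : Λ → T
      depth∈G : ∀ l → G (depth l)

  module _ {G : T → Set g} {o : Level} (Sig : Signature G o) where
    open Signature Sig

    data Formula : Set o where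
      con : Θ → Formula
      op  : (p : 𝒪) → Vec Formula (ar p) → Formula
      mod : Λ → Formula → Formula

    -- UniformDepth k φ means φ ∈ F_k.

    data UniformDepth : T → Formula → Set (a ⊔ o) where
      con : ∀ θ → UniformDepth e (con θ)
      op  : ∀ {k} p {φs : Vec Formula (ar p)} → Vec.All (UniformDepth k) φs →
            UniformDepth k (op p φs)
      mod : ∀ {k l φ} m → UniformDepth l φ → depth m ∙ l ≡ k → UniformDepth k (mod m φ)

  record Logic {G : T → Set g} (𝕄 : GradedMonad ℓ) (o : Level) :
               Set (a ⊔ g ⊔ lsuc ℓ ⊔ lsuc o) where
    open GradedMonad 𝕄
    field
      signature : Signature G o

    open Signature signature public

    field
      Ω     : Set ℓ
      ⟦_⟧ᶿ  : Θ → Ω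
      ⟦_⟧ᵒ  : (p : 𝒪) → Vec Ω (ar p) → Ω
      ⟦_⟧ᵐ  : (m : Λ) → M (depth m) Ω → Ω

    module _ {X : Set ℓ} (γ : Coalgebra 𝕄 X) where

      ⟦_⟧  : Formula signature → X → Ω
      ⟦_⟧* : ∀ {n} → Vec (Formula signature) n → X → Vec Ω n

      ⟦ con θ ⟧   = const ⟦ θ ⟧ᶿ
      ⟦ op p φs ⟧ = ⟦ p ⟧ᵒ ∘ ⟦ φs ⟧*
      ⟦ mod m φ ⟧ = ⟦ m ⟧ᵐ ∘ fmap ⟦ φ ⟧ ∘ Coalgebra.γ γ (depth m)

      ⟦ [] ⟧*     x = []
      ⟦ φ ∷ φs ⟧* x = ⟦ φ ⟧ x ∷ ⟦ φs ⟧* x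

  record IsTraceLogic {G : T → Set g} {𝕄 : GradedMonad ℓ} {o : Level}
                      (L : Logic {G = G} 𝕄 o) : Set (ℓ ⊔ o) where
    open GradedMonad 𝕄
    open Logic L
    field
      act       : M e Ω → Ω
      isAlgebra : IsAlgebra act

    Ω-algebra : Algebra
    Ω-algebra = record { act = act ; isAlgebra = isAlgebra }

    field
      op-hom : ∀ p → IsHom (power Ω-algebra (ar p)) Ω-algebra ⟦ p ⟧ᵒ
      mod-μʳ : ∀ m → ⟦ m ⟧ᵐ ∘ μʳ (depth m) ≗ ⟦ m ⟧ᵐ ∘ fmap act
      mod-μˡ : ∀ m → ⟦ m ⟧ᵐ ∘ μˡ (depth m) ≗ act ∘ fmap ⟦ m ⟧ᵐ

{-# OPTIONS --safe #-}

-- A formula φ of uniform depth k is evaluated by an M_e-algebra homomorphism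
-- ε : M_k 1 → Ω through which every ⟦ φ ⟧_γ factors as ε ∘ M_k ! ∘ γ_k.  Trace
-- equivalent states have the same M_k ! ∘ γ_k, hence satisfy φ alike.  For λ φ with
-- φ evaluated by ε and λ of depth s, the trace logic axioms make ⟦ λ ⟧ ∘ M_s ε a
-- homomorphism that coequalizes M_s μ^{e,l} and μ^{s,e}; uniformity then factors
-- it through μ^{s,l}.

module Submission where

open import Defs
open import Algebra.Structures using (IsMonoid)
open import Data.Fin.Base using (zero; suc)
open import Data.Nat.Base using (suc)
open import Data.Product.Base using (∃-syntax; _,_)
open import Data.Unit.Polymorphic.Base using (⊤; tt)
open import Data.Vec.Base using (Vec; []; _∷_; lookup)
open import Data.Vec.Properties using (tabulate-cong)
import Data.Vec.Relation.Unary.All as Vec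
open import Function.Base using (_∘_; const)
open import Level using (Level; _⊔_) renaming (suc to lsuc)
open import Relation.Binary.PropositionalEquality
  using (_≡_; _≗_; refl; sym; trans; cong; cong₂; module ≡-Reasoning)

module _ {ℓ : Level} (𝕄 : Monad ℓ) where
  open Monad 𝕄
  open EilenbergMoore 𝕄
  open Algebra using (Carrier; act)
  open Hom
  open ≡-Reasoning

  ∘-hom : ∀ {A B C} → Hom B C → Hom A B → Hom A C
  ∘-hom {A} {B} {C} h f = record
    { fun   = fun h ∘ fun f
    ; isHom = λ m → begin
        fun h (fun f (act A m))              ≡⟨ cong (fun h) (isHom f m) ⟩
        fun h (act B (F₁ (fun f) m))         ≡⟨ isHom h _ ⟩
        act C (F₁ (fun h) (F₁ (fun f) m))    ≡⟨ cong (act C) (homomorphism _ _ m) ⟨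
        act C (F₁ (fun h ∘ fun f) m)         ∎
    }

  nil-hom : ∀ {A B} → Hom A (power B 0)
  nil-hom = record { fun = const [] ; isHom = λ _ → refl }

  -- With `nil-hom` this gives tupling into a power, which joins the evaluators of the arguments of
  -- an operator.
  cons-hom : ∀ {A B n} → Hom A B → Hom A (power B n) → Hom A (power B (suc n))
  cons-hom {A} {B} h hs = record
    { fun   = λ x → fun h x ∷ fun hs x
    ; isHom = λ m → cong₂ _∷_
        (trans (isHom h m) (cong (act B) (homomorphism _ (λ v → lookup v zero) m)))
        -- Looking up `suc i` in the extended tuple is definitionally looking up `i` in its tail, so
        -- functoriality is applied once in each direction.
        (trans (isHom hs m) (tabulate-cong λ i → cong (act B)
          (trans (sym (homomorphism _ (λ v → lookup v i) m))
                 (homomorphism _ (λ v → lookup v (suc i)) m))))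
    }

module _ {a ℓ : Level} {T : Set a} {_∙_ : T → T → T} {e : T}
         (isMonoid : IsMonoid _≡_ _∙_ e) (𝕄 : GradedMonad isMonoid ℓ) where

  open GradedMonad 𝕄
  open Hom
  open ≡-Reasoning

  fmap-cong : ∀ {t A B} {f h : A → B} → f ≗ h → fmap {t} f ≗ fmap h
  fmap-cong {t} = Functor.F-resp-≗ (functor t)

  fmap-∘ : ∀ {t A B C} (f : A → B) (h : B → C) → fmap {t} (h ∘ f) ≗ fmap h ∘ fmap f
  fmap-∘ {t} = Functor.homomorphism (functor t)

  -- A free index `u` allows matching on `refl`, and the result covers both `μˡ` and `μʳ`.
  cast-μ-natural : ∀ {s t u A B} (p : s ∙ t ≡ u) (f : A → B) →
                   cast p ∘ μ s t ∘ fmap (fmap f) ≗ fmap f ∘ cast p ∘ μ s t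
  cast-μ-natural {s} {t} refl f = μ-natural s t f

  fmap-hom : ∀ {t A B} (f : A → B) → Hom (algebra t A) (algebra t B)
  fmap-hom f = record
    { fun   = fmap f
    ; isHom = λ m → sym (cast-μ-natural _ f m)
    }

  -- Homomorphic extension from the free algebra on `A`: the multiplication law of `B` makes its
  -- action a homomorphism, composed here with `fmap f`.
  extend : ∀ {A} (B : Algebra) → (A → Algebra.Carrier B) → Hom (algebra e A) B
  extend B f = ∘-hom base
    (record { fun = act ; isHom = λ m → sym (mult m) }) (fmap-hom f)
    where open Algebra B

  extend-η : ∀ {A} (B : Algebra) (f : A → Algebra.Carrier B) → fun (extend B f) ∘ η ≗ f
  extend-η B f x = trans (cong act (sym (η-natural f x))) (unit (f x))
    where open Algebra B

  -- The values that trace equivalence compares: whatever factors through them is invariant.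
  behaviour : ∀ {X} → Coalgebra isMonoid 𝕄 X → ∀ t → X → M t ⊤
  behaviour γ t = fmap (const tt) ∘ Coalgebra.γ γ t

  behaviour-∙ : ∀ {X} (γ : Coalgebra isMonoid 𝕄 X) s t →
                behaviour γ (s ∙ t) ≗ μ s t ∘ fmap (behaviour γ t) ∘ Coalgebra.γ γ s
  behaviour-∙ γ s t x = begin
    fmap (const tt) (Coalgebra.γ γ (s ∙ t) x)
      ≡⟨ cong (fmap (const tt)) (Coalgebra.mult γ s t x) ⟩
    fmap (const tt) (μ s t (fmap (Coalgebra.γ γ t) (Coalgebra.γ γ s x)))
      ≡⟨ μ-natural s t (const tt) _ ⟨
    μ s t (fmap (fmap (const tt)) (fmap (Coalgebra.γ γ t) (Coalgebra.γ γ s x)))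
      ≡⟨ cong (μ s t) (fmap-∘ _ _ _) ⟨
    μ s t (fmap (behaviour γ t) (Coalgebra.γ γ s x)) ∎

  module _ {g o : Level} {G : T → Set g} (uniform : Uniform isMonoid 𝕄 G)
           (L : Logic isMonoid {G = G} 𝕄 o) (isTraceLogic : IsTraceLogic isMonoid L) where

    open Logic L
    open IsTraceLogic isTraceLogic using (act; Ω-algebra; op-hom; mod-μʳ; mod-μˡ)

    mod-hom : ∀ {l} m → Hom (algebra l ⊤) Ω-algebra →
              Hom (algebra (depth m) (M l ⊤)) Ω-algebra
    mod-hom m ε = record
      { fun   = ⟦ m ⟧ᵐ ∘ fmap (fun ε)
      ; isHom = λ z → begin
          ⟦ m ⟧ᵐ (fmap (fun ε) (μˡ _ z))            ≡⟨ cong ⟦ m ⟧ᵐ (cast-μ-natural _ (fun ε) z) ⟨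
          ⟦ m ⟧ᵐ (μˡ _ (fmap (fmap (fun ε)) z))     ≡⟨ mod-μˡ m _ ⟩
          act (fmap ⟦ m ⟧ᵐ (fmap (fmap (fun ε)) z)) ≡⟨ cong act (fmap-∘ _ _ z) ⟨
          act (fmap (⟦ m ⟧ᵐ ∘ fmap (fun ε)) z)      ∎
      }

    -- As `ε` is a homomorphism, `μˡ l` under `fmap` becomes `act`; `mod-μʳ` trades `act` for `μʳ`,
    -- which naturality moves back past `ε`.
    mod-hom-coequalizes : ∀ {l} m (ε : Hom (algebra l ⊤) Ω-algebra) →
                          fun (mod-hom m ε) ∘ fmap (μˡ l) ≗ fun (mod-hom m ε) ∘ μʳ (depth m)
    mod-hom-coequalizes {l} m ε z = begin
      ⟦ m ⟧ᵐ (fmap (fun ε) (fmap (μˡ l) z))     ≡⟨ cong ⟦ m ⟧ᵐ (fmap-∘ _ _ z) ⟨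
      ⟦ m ⟧ᵐ (fmap (fun ε ∘ μˡ l) z)            ≡⟨ cong ⟦ m ⟧ᵐ (fmap-cong (isHom ε) z) ⟩
      ⟦ m ⟧ᵐ (fmap (act ∘ fmap (fun ε)) z)      ≡⟨ cong ⟦ m ⟧ᵐ (fmap-∘ _ _ z) ⟩
      ⟦ m ⟧ᵐ (fmap act (fmap (fmap (fun ε)) z)) ≡⟨ mod-μʳ m _ ⟨
      ⟦ m ⟧ᵐ (μʳ _ (fmap (fmap (fun ε)) z))     ≡⟨ cong ⟦ m ⟧ᵐ (cast-μ-natural _ (fun ε) z) ⟩
      ⟦ m ⟧ᵐ (fmap (fun ε) (μʳ _ z))            ∎

    -- One `ε` serves all coalgebras, which is what lets states of different ones be compared.
    Evaluates : ∀ {k} → Hom (algebra k ⊤) Ω-algebra → Formula isMonoid signature →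
                Set (a ⊔ lsuc ℓ)
    Evaluates {k} ε φ = ∀ {X} (γ : Coalgebra isMonoid 𝕄 X) → ⟦_⟧ γ φ ≗ fun ε ∘ behaviour γ k

    Evaluates* : ∀ {k n} → Hom (algebra k ⊤) (power Ω-algebra n) →
                 Vec (Formula isMonoid signature) n → Set (a ⊔ lsuc ℓ)
    Evaluates* {k} εs φs =
      ∀ {X} (γ : Coalgebra isMonoid 𝕄 X) → ⟦_⟧* γ φs ≗ fun εs ∘ behaviour γ k

    -- The induction must produce homomorphisms, not mere maps: `mod-hom-coequalizes` relies on this
    -- for the subformula.
    evaluate  : ∀ {k φ} → UniformDepth isMonoid signature k φ → ∃[ ε ] Evaluates {k} ε φ
    evaluate* : ∀ {k n} {φs : Vec (Formula isMonoid signature) n} →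
                Vec.All (UniformDepth isMonoid signature k) φs → ∃[ εs ] Evaluates* {k} εs φs

    -- At depth `e` the behaviour of every state is `η tt`, since the coalgebra map there is `η`.
    evaluate (con θ) = extend Ω-algebra (const ⟦ θ ⟧ᶿ) , λ γ x → sym (begin
      fun ε (fmap (const tt) (Coalgebra.γ γ e x))  ≡⟨ cong (fun ε ∘ fmap _) (Coalgebra.unit γ x) ⟩
      fun ε (fmap (const tt) (η x))                ≡⟨ cong (fun ε) (η-natural _ x) ⟨
      fun ε (η tt)                                 ≡⟨ extend-η Ω-algebra _ tt ⟩
      ⟦ θ ⟧ᶿ                                       ∎)
      where ε = extend Ω-algebra (const ⟦ θ ⟧ᶿ)
    evaluate (op p ds) with evaluate* ds
    ... | εs , εs-evaluates =
      ∘-hom base (record { fun = ⟦ p ⟧ᵒ ; isHom = op-hom p }) εs ,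
      λ γ x → cong ⟦ p ⟧ᵒ (εs-evaluates γ x)
    evaluate (mod {l = l} {φ = φ} m d refl) with evaluate d
    ... | ε , ε-evaluates
      -- The factor `ε′` of `mod-hom m ε` through `μ` evaluates the modal formula, because
      -- `behaviour-∙` presents the behaviour at the product depth as an image under `μ`.
      with IsCoequalizer.universal (uniform (depth m) (depth∈G m) l ⊤)
             Ω-algebra (mod-hom m ε) (mod-hom-coequalizes m ε)
    ... | ε′ , ε′∘μ≗mod-hom , _ = ε′ , λ γ x → let z = Coalgebra.γ γ (depth m) x in begin
      ⟦ m ⟧ᵐ (fmap (⟦_⟧ γ φ) z)                      ≡⟨ cong ⟦ m ⟧ᵐ (fmap-cong (ε-evaluates γ) z) ⟩
      ⟦ m ⟧ᵐ (fmap (fun ε ∘ behaviour γ l) z)        ≡⟨ cong ⟦ m ⟧ᵐ (fmap-∘ _ _ z) ⟩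
      fun (mod-hom m ε) (fmap (behaviour γ l) z)     ≡⟨ ε′∘μ≗mod-hom _ ⟨
      fun ε′ (μ _ l (fmap (behaviour γ l) z))        ≡⟨ cong (fun ε′) (behaviour-∙ γ (depth m) l x) ⟨
      fun ε′ (behaviour γ (depth m ∙ l) x)           ∎

    evaluate* Vec.[] = nil-hom base {B = Ω-algebra} , λ _ _ → refl
    evaluate* (d Vec.∷ ds) with evaluate d | evaluate* ds
    ... | ε , ε-evaluates | εs , εs-evaluates =
      cons-hom base ε εs , λ γ x → cong₂ _∷_ (ε-evaluates γ x) (εs-evaluates γ x)

theorem5p13 : ∀ {a g ℓ o : Level}
    {T : Set a} {_∙_ : T → T → T} {e : T} (isMonoid : IsMonoid _≡_ _∙_ e)
    (G : T → Set g) → Generates isMonoid G →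
    (𝕄 : GradedMonad isMonoid ℓ) → Uniform isMonoid 𝕄 G →
    (L : Logic isMonoid {G = G} 𝕄 o) → IsTraceLogic isMonoid L →
    {X Y : Set ℓ} (γ : Coalgebra isMonoid 𝕄 X) (δ : Coalgebra isMonoid 𝕄 Y) (x : X) (y : Y) →
    TraceEquivalent isMonoid 𝕄 γ δ x y →
    ∀ k φ → UniformDepth isMonoid (Logic.signature L) k φ →
    Logic.⟦_⟧ L γ φ x ≡ Logic.⟦_⟧ L δ φ y
theorem5p13 isMonoid G _ 𝕄 uniform L isTraceLogic γ δ x y x≈y k φ d
  with evaluate isMonoid 𝕄 uniform L isTraceLogic d
... | ε , ε-evaluates = begin
  Logic.⟦_⟧ L γ φ x                    ≡⟨ ε-evaluates γ x ⟩
  ε.fun (behaviour isMonoid 𝕄 γ k x)   ≡⟨ cong ε.fun (x≈y k) ⟩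
  ε.fun (behaviour isMonoid 𝕄 δ k y)   ≡⟨ ε-evaluates δ y ⟨
  Logic.⟦_⟧ L δ φ y                    ∎
  where
  module ε = GradedMonad.Hom 𝕄 ε
  open ≡-Reasoning
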